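{- Let $X$ be a finite set. For any $\ast\in\mathcal{M}(X)$, the principal left ideal generated by $\ast$ is $$\mathcal{M}(X)\ast=\{\diamond\in\mathcal{M}(X) : im(T_\diamond)\subseteq im(T_\ast)\text{ and } diag(T_\diamond)\subseteq diag(T_\ast)\}.$$
   Context: $\mathcal{M}(X)=X^{X\times X}$ is the set of all binary operations on $X$, a monoid under $\triangleright$ defined by $a(\circ\triangleright\ast)b=(a\circ b)\ast(b\circ a)$ for all $a,b\in X$, with identity $a\circ_{lz}b=a$. The principal left ideal generated by $\ast$ is $\mathcal{M}(X)\ast=\{\circ\triangleright\ast : \circ\in\mathcal{M}(X)\}$. The pairmorph transformation induced by $\ast\in\mathcal{M}(X)$ is $T_\ast:X\times X\to X\times X$, $T_\ast(a,b)=(a\ast b,b\ast a)$. With $\Delta(X)=\{(x,x):x\in X\}$, the pairmorph image is $im(T_\ast)=T_\ast(X\times X)$ and the diagonal image is $diag(T_\ast)=T_\ast(\Delta(X))$. -}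

module Defs where

open import Algebra.Bundles using (Monoid)
open import Algebra.Core using (Op₂)
open import Data.Fin.Base using (Fin)
open import Data.Nat.Base using (ℕ)
open import Data.Product.Base using (∃; _×_; _,_)
open import Function.Bundles using (_↔_)
open import Level using (Level; _⊔_)
open import Relation.Binary.PropositionalEquality using (_≡_; refl; sym; trans; cong₂)
open import Relation.Unary using (Pred; _∈_; U)

private
  variable
    a b c ℓ : Level

Finite : Set a → Set a
Finite X = ∃ λ (n : ℕ) → X ↔ Fin n

-- Binary operations in curried form, as in the library's algebra hierarchy.
𝓜 : Set a → Set a
𝓜 X = Op₂ X

module _ {X : Set a} where

  -- Equality of operations is pointwise: function extensionality is not
  -- available, and _≡_ on functions would be finer than equality in X^(X×X).
  infix 4 _≈_
  _≈_ : 𝓜 X → 𝓜 X → Set a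
  _∘_ ≈ _∗_ = ∀ x y → x ∘ y ≡ x ∗ y

  infixl 7 _▷_
  _▷_ : 𝓜 X → 𝓜 X → 𝓜 X
  (_∘_ ▷ _∗_) x y = (x ∘ y) ∗ (y ∘ x)

  lz : 𝓜 X
  lz x y = x

𝓜-monoid : Set a → Monoid a a
𝓜-monoid X = record
  { Carrier  = 𝓜 X
  ; _≈_      = _≈_
  ; _∙_      = _▷_
  ; ε        = lz
  ; isMonoid = record
    { isSemigroup = record
      { isMagma = record
        { isEquivalence = record
          { refl  = λ x y → refl
          ; sym   = λ p x y → sym (p x y)
          ; trans = λ p q x y → trans (p x y) (q x y)
          }
        ; ∙-cong = λ {_} {_} {_∗_} p q x y →
            trans (cong₂ _∗_ (p x y) (p y x)) (q _ _)
        }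
      ; assoc = λ _ _ _ x y → refl
      }
    ; identity = (λ _ x y → refl) , (λ _ x y → refl)
    }
  }

module _ (M : Monoid c ℓ) where
  open Monoid M using (Carrier; _∙_) renaming (_≈_ to _≈ᴹ_)

  principalLeftIdeal : Carrier → Pred Carrier (c ⊔ ℓ)
  principalLeftIdeal x y = ∃ λ z → z ∙ x ≈ᴹ y

image : {A : Set a} {B : Set b} → (A → B) → Pred A ℓ → Pred B (a ⊔ b ⊔ ℓ)
image f S y = ∃ λ x → x ∈ S × f x ≡ y

module _ {X : Set a} where

  Δ : Pred (X × X) a
  Δ p = ∃ λ x → p ≡ (x , x)

  T : 𝓜 X → X × X → X × X
  T _∗_ (x , y) = (x ∗ y) , (y ∗ x)

  im : (X × X → X × X) → Pred (X × X) a
  im f = image f U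

  diag : (X × X → X × X) → Pred (X × X) a
  diag f = image f Δ

{-# OPTIONS --safe #-}
-- Given ⋄ with T ⋄ taking values in im (T ∗), a left factor ∘ amounts to a choice of
-- T ∗-preimages (x ∘ y , y ∘ x) of T ⋄ (x , y) that is compatible with swapping x and y.
-- For x ≢ y, a linear order of X selects one of (x , y) and (y , x), whose preimage is
-- used for both, while for x ≡ y compatibility says that the preimage is diagonal.
module Submission where

open import Defs
open import Data.Fin.Base using (_≤_)
open import Data.Fin.Properties using (_≤?_; ≤-antisym; ≤-total)
open import Data.Product.Base using (_×_; _,_; proj₁; proj₂)
open import Data.Sum.Base using ([_,_])
open import Function.Base using (_on_)
open import Function.Bundles using (module Injection)
open import Function.Properties.Inverse using (↔⇒↣)
open import Level using (Level)
open import Relation.Binary.Core using (Rel)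
open import Relation.Binary.Definitions using (Antisymmetric; Decidable; Total)
open import Relation.Binary.PropositionalEquality using (_≡_; refl; cong; cong₂)
open import Relation.Nullary using (Dec; yes; no; contradiction)
open import Relation.Unary using (_∈_; _⊆_; _≐_)

private
  variable
    a ℓ : Level

module _ {X : Set a} (∗ ⋄ : 𝓜 X) where

  leftMultiple⇒im⊆ : ⋄ ∈ principalLeftIdeal (𝓜-monoid X) ∗ → im (T ⋄) ⊆ im (T ∗)
  leftMultiple⇒im⊆ (∘ , eq) ((x , y) , _ , refl) =
    (∘ x y , ∘ y x) , _ , cong₂ _,_ (eq x y) (eq y x)

  leftMultiple⇒diag⊆ : ⋄ ∈ principalLeftIdeal (𝓜-monoid X) ∗ → diag (T ⋄) ⊆ diag (T ∗)
  leftMultiple⇒diag⊆ (∘ , eq) (_ , (x , refl) , refl) =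
    (∘ x x , ∘ x x) , (∘ x x , refl) , cong₂ _,_ (eq x x) (eq x x)

  module _ {_≼_ : Rel X ℓ} (_≼?_ : Decidable _≼_) (total : Total _≼_)
           (antisym : Antisymmetric _≡_ _≼_)
           (im⊆ : im (T ⋄) ⊆ im (T ∗)) (diag⊆ : diag (T ⋄) ⊆ diag (T ∗)) where

    private
      preimage : ∀ x y → T ⋄ (x , y) ∈ im (T ∗)
      preimage x y = im⊆ ((x , y) , _ , refl)

      diagPreimage : ∀ x → T ⋄ (x , x) ∈ diag (T ∗)
      diagPreimage x = diag⊆ ((x , x) , (x , refl) , refl)

      -- Both decisions are arguments, so a single case split evaluates the factor at `(x , y)` and,
      -- with the decisions swapped, at `(y , x)`.
      factor : ∀ x y → Dec (x ≼ y) → Dec (y ≼ x) → X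
      factor x y (yes _) (yes _) = proj₁ (proj₁ (diagPreimage x))
      factor x y (yes _) (no _)  = proj₁ (proj₁ (preimage x y))
      -- By totality `y` strictly precedes `x`, so `(y , x)` is the selected pair and its preimage
      -- is read backwards.
      factor x y (no _)  _       = proj₂ (proj₁ (preimage y x))

      factor-correct : ∀ x y (x≼?y : Dec (x ≼ y)) (y≼?x : Dec (y ≼ x)) →
                       ∗ (factor x y x≼?y y≼?x) (factor y x y≼?x x≼?y) ≡ ⋄ x y
      -- Once `x` and `y` are identified, both factors come from the same preimage, whose two
      -- coordinates agree because it lies in `Δ`.
      factor-correct x y (yes x≼y) (yes y≼x) with refl ← antisym x≼y y≼x
        with _ , (_ , refl) , eq ← diagPreimage x = cong proj₁ eq
      factor-correct x y (yes _)   (no _)    = cong proj₁ (proj₂ (proj₂ (preimage x y)))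
      -- If `(p , q)` is the preimage of `T ⋄ (y , x)`, the factors are `q` and `p`, and the second
      -- coordinate gives `∗ q p ≡ ⋄ x y`.
      factor-correct x y (no _)    (yes _)   = cong proj₂ (proj₂ (proj₂ (preimage y x)))
      factor-correct x y (no x⋠y)  (no y⋠x)  =
        contradiction (total x y) [ x⋠y , y⋠x ]

    im⊆∧diag⊆⇒leftMultiple : ⋄ ∈ principalLeftIdeal (𝓜-monoid X) ∗
    im⊆∧diag⊆⇒leftMultiple =
      (λ x y → factor x y (x ≼? y) (y ≼? x)) ,
      (λ x y → factor-correct x y (x ≼? y) (y ≼? x))

theorem4 : ∀ {a} (X : Set a) → Finite X → (∗ : 𝓜 X) →
    principalLeftIdeal (𝓜-monoid X) ∗
    ≐ (λ (⋄ : 𝓜 X) → im (T ⋄) ⊆ im (T ∗) × diag (T ⋄) ⊆ diag (T ∗))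
theorem4 X (_ , X↔Fin) ∗ =
  (λ {⋄} ⋄∈ → leftMultiple⇒im⊆ ∗ ⋄ ⋄∈ , leftMultiple⇒diag⊆ ∗ ⋄ ⋄∈) ,
  -- Finiteness supplies the linear order: that of `Fin` pulled back along `index`, antisymmetric
  -- since `index` is injective.
  (λ {⋄} (im⊆ , diag⊆) → im⊆∧diag⊆⇒leftMultiple ∗ ⋄ {_≼_ = _≤_ on index}
    (λ x y → index x ≤? index y)
    (λ x y → ≤-total (index x) (index y))
    (λ x≼y y≼x → injective (≤-antisym x≼y y≼x))
    im⊆ diag⊆)
  where
  open Injection (↔⇒↣ X↔Fin) using (injective) renaming (to to index)
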